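{- Let $\epsilon < \frac{1}{23}$ be a real number. Let $G$ be a finite bipartite graph with bipartition $(L,R)$ such that each vertex in $L$ has degree at most $3$ and no two distinct degree-$3$ vertices of $L$ have the same set of neighbours. Suppose $|N_G(L)| \geq (2-\epsilon)|L|$ and that for every proper subset $L' \subsetneq L$ there is a $(2,4)$-matching in $G$ covering $L'$. Then there is a $(2,4)$-matching in $G$ covering $L$.
   Context: For a bipartite graph $G$ with bipartition $(L,R)$, a $(2,4)$-matching in $G$ is a subgraph $F$ of $G$ such that (1) each connected component of $F$ is a tree with at most $4$ edges, and (2) each vertex in $V(F)\cap L$ has degree exactly $2$ in $F$. A $(2,4)$-matching $F$ covers a set of vertices $S$ if $S \subseteq V(F)$. $N_G(A)$ denotes the set of neighbours in $G$ of vertices of $A$. -}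

module Defs where

open import Data.Nat using (ℕ; zero; suc; _+_; _≤_)
open import Data.Bool using (Bool; true; false; if_then_else_; _∨_)
open import Data.Fin using (Fin; zero; suc; inject₁; fromℕ)
open import Data.Sum using (_⊎_; inj₁; inj₂)
open import Data.Product using (_×_; _,_; Σ; ∃)
open import Data.Empty using (⊥)
open import Relation.Binary.PropositionalEquality using (_≡_; _≢_)
open import Relation.Nullary using (¬_)
open import Function.Definitions using (Injective)
import Data.Integer as ℤ
open import Data.Rational using (ℚ; _/_)

count : (k : ℕ) → (Fin k → Bool) → ℕ
count zero    p = 0
count (suc k) p = (if p zero then 1 else 0) + count k (λ i → p (suc i))

anyF : (k : ℕ) → (Fin k → Bool) → Bool
anyF zero    p = false
anyF (suc k) p = p zero ∨ anyF k (λ i → p (suc i))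

record BipGraph : Set where
  field
    m   : ℕ
    n   : ℕ
    adj : Fin m → Fin n → Bool

module _ (G : BipGraph) where
  open BipGraph G

  Vtx : Set
  Vtx = Fin m ⊎ Fin n

  degL : Fin m → ℕ
  degL x = count n (adj x)

  sizeNL : ℕ
  sizeNL = count n (λ y → anyF m (λ x → adj x y))

  record Subgraph : Set where
    field
      inL  : Fin m → Bool
      inR  : Fin n → Bool
      edge : Fin m → Fin n → Bool
      edge⊆G : ∀ x y → edge x y ≡ true → adj x y ≡ true
      edge-endL : ∀ x y → edge x y ≡ true → inL x ≡ true
      edge-endR : ∀ x y → edge x y ≡ true → inR y ≡ true

  module _ (F : Subgraph) where
    open Subgraph F

    inV : Vtx → Set
    inV (inj₁ x) = inL x ≡ true
    inV (inj₂ y) = inR y ≡ true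

    degF : Fin m → ℕ
    degF x = count n (edge x)

    AdjF : Vtx → Vtx → Set
    AdjF (inj₁ x) (inj₂ y) = edge x y ≡ true
    AdjF (inj₂ y) (inj₁ x) = edge x y ≡ true
    AdjF (inj₁ _) (inj₁ _) = ⊥
    AdjF (inj₂ _) (inj₂ _) = ⊥

    -- walks in F; u and v lie in the same component of F iff Walk u v
    data Walk : Vtx → Vtx → Set where
      here : ∀ {u} → inV u → Walk u u
      step : ∀ {u v w} → AdjF u v → Walk v w → Walk u w

    record Cycle : Set where
      field
        k    : ℕ
        c    : Fin (suc (suc (suc k))) → Vtx
        inj  : Injective _≡_ _≡_ c
        cons : ∀ (i : Fin (suc (suc k))) → AdjF (c (inject₁ i)) (c (suc i))
        close : AdjF (c (fromℕ (suc (suc k)))) (c zero)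

    Acyclic : Set
    Acyclic = ¬ Cycle

    ComponentAtMost4Edges : Vtx → Set
    ComponentAtMost4Edges v =
      (e : Fin 5 → Fin m × Fin n) → Injective _≡_ _≡_ e →
      (∀ i → let (x , y) = e i in (edge x y ≡ true) × Walk v (inj₁ x)) → ⊥

  -- (2,4)-matching: every component of F is a tree (connected by
  -- definition, and acyclic) with at most 4 edges, and every vertex of
  -- V(F) ∩ L has degree exactly 2 in F.
  record Matching24 : Set where
    field
      F : Subgraph
      acyclic : Acyclic F
      small   : ∀ v → ComponentAtMost4Edges F v
      deg2    : ∀ x → Subgraph.inL F x ≡ true → degF F x ≡ 2

  Covers : Matching24 → (Fin m → Bool) → Set
  Covers M S = ∀ x → S x ≡ true → Subgraph.inL (Matching24.F M) x ≡ true

  ProperSubsetL : (Fin m → Bool) → Set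
  ProperSubsetL S = ∃ λ x → S x ≡ false

  allL : Fin m → Bool
  allL _ = true

  DistinctDeg3Nbhds : Set
  DistinctDeg3Nbhds = ∀ x x' → x ≢ x' → degL x ≡ 3 → degL x' ≡ 3 →
                      ¬ (∀ y → adj x y ≡ adj x' y)

ℕtoℚ : ℕ → ℚ
ℕtoℚ k = ℤ.+ k / 1

-- Suppose some right vertex r of degree one or two is such that each of its
-- neighbours also has a neighbour of degree one other than r.  Each neighbour
-- x of r can then take r and such a pendant vertex; this is a path with at most
-- four edges, disjoint from N(L ∖ N(r)), so it extends any (2,4)-matching
-- covering L ∖ N(r).  If there is no such r, then a discharging argument, in
-- which every vertex of L gives at most 9 units and every vertex of N(L)
-- receives at least 5, shows 5|N(L)| ≤ 9|L|, and 9/5 < 45/23 < 2 - ε.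
module Submission where

open import Defs
open import Data.Nat using (ℕ; zero; suc; _≤_; z≤n; s≤s)
open import Data.Rational using (ℚ; _<_; _*_; _-_; _/_)
import Data.Rational as Q
import Data.Rational.Properties as Q
import Data.Rational.Unnormalised as ℚᵘ
import Data.Rational.Unnormalised.Properties as ℚᵘ
open import Data.Integer using (+_)
import Data.Integer as ℤ
import Data.Integer.Properties as ℤ
open import Data.Product using (∃; _×_; _,_; proj₁; proj₂)
open import Relation.Binary.PropositionalEquality using (_≡_; _≢_; refl; sym; trans; cong; cong₂; subst)
import Data.Nat as ℕ
import Data.Nat.Properties as ℕ
open import Data.Nat.Tactic.RingSolver using (solve-∀)
open import Algebra.Properties.CommutativeMonoid.Sum ℕ.+-0-commutativeMonoid using (sum; ∑-comm)
open import Data.Bool using (Bool; true; false; not; _∧_; _∨_; if_then_else_)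
import Data.Bool.Properties as Bool
open import Data.Empty using (⊥; ⊥-elim)
open import Data.Fin using (Fin; zero; suc; inject₁; fromℕ; _↑ʳ_; combine)
open import Data.Fin.Induction using (<-weakInduction)
open import Data.Fin.Properties using (_≟_; any?; all?; ↑ʳ-injective; combine-injective; injective⇒≤)
open import Data.Sum using (inj₁; inj₂; _⊎_; [_,_]′)
open import Function using (_∘_)
open import Function.Definitions using (Injective)
open import Relation.Nullary using (¬_; Dec; yes; no; does; contradiction)
open import Relation.Nullary.Decidable using (_×-dec_; _→-dec_; ¬?; dec-true)

-- Counting the elements of a finite set that satisfy a Boolean predicate.

indicator : Bool → ℕ
indicator b = if b then 1 else 0

private
  variable
    k : ℕ

false≢true : {A : Set} {b : Bool} → b ≡ false → b ≡ true → A
false≢true refl ()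

does-sound : {A : Set} (d : Dec A) → does d ≡ true → A
does-sound (yes a) _ = a

∧-true : ∀ {a b} → a ∧ b ≡ true → a ≡ true × b ≡ true
∧-true {true} eq = refl , eq

∨-true : ∀ {a b} → a ∨ b ≡ true → a ≡ true ⊎ b ≡ true
∨-true {true}  _  = inj₁ refl
∨-true {false} eq = inj₂ eq

anyF-complete : (p : Fin k → Bool) → ∀ i → p i ≡ true → anyF k p ≡ true
anyF-complete p zero    eq rewrite eq = refl
anyF-complete p (suc i) eq with p zero
... | true  = refl
... | false = anyF-complete (p ∘ suc) i eq

anyF-sound : (p : Fin k → Bool) → anyF k p ≡ true → ∃ λ i → p i ≡ true
anyF-sound {suc k} p eq with ∨-true {p zero} eq
... | inj₁ p0 = zero , p0
... | inj₂ ps with i , pi ← anyF-sound (p ∘ suc) ps = suc i , pi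

first : ∀ b {c} → b ≡ true → Fin (indicator b ℕ.+ c)
first true _ = zero

first-minimal : ∀ b {c} (eq : b ≡ true) (j : Fin c) → first b eq ≢ indicator b ↑ʳ j
first-minimal true _ _ ()

-- The number of earlier elements satisfying `p`, as an index below the count. Being injective, it
-- yields uniqueness when the count is at most one, and later codes edges by small numbers.
rank : (p : Fin k → Bool) (i : Fin k) → p i ≡ true → Fin (count k p)
rank p zero    eq = first (p zero) eq
rank p (suc i) eq = indicator (p zero) ↑ʳ rank (p ∘ suc) i eq

rank-injective : (p : Fin k → Bool) (i j : Fin k) (pi : p i ≡ true) (pj : p j ≡ true) →
                 rank p i pi ≡ rank p j pj → i ≡ j
rank-injective p zero    zero    _  _  _  = refl
rank-injective p zero    (suc j) pi _  eq = contradiction eq (first-minimal (p zero) pi _)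
rank-injective p (suc i) zero    _  pj eq = contradiction (sym eq) (first-minimal (p zero) pj _)
rank-injective p (suc i) (suc j) pi pj eq =
  cong suc (rank-injective (p ∘ suc) i j pi pj (↑ʳ-injective (indicator (p zero)) _ _ eq))

count-witness : (p : Fin k → Bool) → 1 ≤ count k p → ∃ λ i → p i ≡ true
count-witness {suc k} p h with p zero in eq
... | true  = zero , eq
... | false with i , pi ← count-witness (p ∘ suc) h = suc i , pi

count-positive : (p : Fin k → Bool) → ∀ i → p i ≡ true → 1 ≤ count k p
count-positive {k} p i eq with count k p | rank p i eq
... | suc _ | _ = s≤s z≤n

count-unique : (p : Fin k → Bool) → count k p ≤ 1 → ∀ i j → p i ≡ true → p j ≡ true → i ≡ j
count-unique {k} p h i j pi pj = rank-injective p i j pi pj (same _ h _ _)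
  where
  same : ∀ c → c ≤ 1 → (a b : Fin c) → a ≡ b
  same 1 _ zero zero = refl
  same (suc (suc _)) (s≤s ()) _ _

count-cong : {p q : Fin k → Bool} → (∀ i → p i ≡ q i) → count k p ≡ count k q
count-cong {zero}  eq = refl
count-cong {suc k} eq = cong₂ ℕ._+_ (cong indicator (eq zero)) (count-cong (eq ∘ suc))

count-none : (p : Fin k → Bool) → (∀ i → p i ≡ false) → count k p ≡ 0
count-none {zero}  p h = refl
count-none {suc k} p h rewrite h zero = count-none (p ∘ suc) (h ∘ suc)

count-pair-witness : (p : Fin k → Bool) → 2 ≤ count k p →
                     ∃ λ i → ∃ λ j → i ≢ j × p i ≡ true × p j ≡ true
count-pair-witness {suc k} p h with p zero in eq
count-pair-witness {suc k} p (s≤s h) | true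
  with j , pj ← count-witness (p ∘ suc) h = zero , suc j , (λ ()) , eq , pj
count-pair-witness {suc k} p h | false
  with i , j , i≢j , pi , pj ← count-pair-witness (p ∘ suc) h =
  suc i , suc j , (λ { refl → i≢j refl }) , pi , pj

count-singleton : (r : Fin k) → count k (λ i → does (i ≟ r)) ≡ 1
count-singleton {suc k} zero = cong suc (count-none {k} (λ _ → false) (λ _ → refl))
count-singleton (suc r) = count-singleton r

count-doubleton : (r s : Fin k) → r ≢ s → count k (λ i → does (i ≟ r) ∨ does (i ≟ s)) ≡ 2
count-doubleton zero    zero    r≢s = contradiction refl r≢s
count-doubleton zero    (suc s) _   = cong suc (count-singleton s)
count-doubleton (suc r) zero    _   =
  cong suc (trans (count-cong (λ i → Bool.∨-identityʳ (does (i ≟ r)))) (count-singleton r))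
count-doubleton (suc r) (suc s) r≢s = count-doubleton r s (r≢s ∘ cong suc)

-- Linearity in the exact shape of `weight`, so that it evaluates the sum for a fixed left vertex as
-- well as for a fixed right vertex.
count-combination : (p q s : Fin k → Bool) →
  sum (λ i → 2 ℕ.* indicator (p i) ℕ.+ 3 ℕ.* indicator (q i) ℕ.+ indicator (s i)) ≡
  2 ℕ.* count k p ℕ.+ 3 ℕ.* count k q ℕ.+ count k s
count-combination {zero}  p q s = refl
count-combination {suc k} p q s =
  trans (cong (2 ℕ.* indicator (p zero) ℕ.+ 3 ℕ.* indicator (q zero) ℕ.+ indicator (s zero) ℕ.+_)
              (count-combination (p ∘ suc) (q ∘ suc) (s ∘ suc)))
        (rearrange (indicator (p zero)) (indicator (q zero)) (indicator (s zero))
          (count k (p ∘ suc)) (count k (q ∘ suc)) (count k (s ∘ suc)))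
  where
  rearrange : ∀ a b c a' b' c' →
    2 ℕ.* a ℕ.+ 3 ℕ.* b ℕ.+ c ℕ.+ (2 ℕ.* a' ℕ.+ 3 ℕ.* b' ℕ.+ c') ≡
    2 ℕ.* (a ℕ.+ a') ℕ.+ 3 ℕ.* (b ℕ.+ b') ℕ.+ (c ℕ.+ c')
  rearrange = solve-∀

sum-upper-bound : ∀ c (f : Fin k → ℕ) → (∀ i → f i ≤ c) → sum f ≤ k ℕ.* c
sum-upper-bound {zero}  c f h = z≤n
sum-upper-bound {suc k} c f h = ℕ.+-mono-≤ (h zero) (sum-upper-bound c (f ∘ suc) (h ∘ suc))

count-sum-bound : ∀ c (p : Fin k → Bool) (f : Fin k → ℕ) →
                  (∀ i → p i ≡ true → c ≤ f i) → count k p ℕ.* c ≤ sum f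
count-sum-bound {zero}  c p f h = z≤n
count-sum-bound {suc k} c p f h with p zero in eq
... | true  = ℕ.+-mono-≤ (h zero eq) (count-sum-bound c (p ∘ suc) (f ∘ suc) (h ∘ suc))
... | false = ℕ.≤-trans (count-sum-bound c (p ∘ suc) (f ∘ suc) (h ∘ suc)) (ℕ.m≤n+m _ (f zero))

module _ (G : BipGraph) where
  open BipGraph G
  open Subgraph
  open Matching24

  -- Gluing matchings along a partition of the vertices.

  module _ {I : Set} (M : I → Matching24 G) (S : Fin m → I) (T : Fin n → I)
           (compatible : ∀ x y → edge (F (M (S x))) x y ≡ true → T y ≡ S x) where

    glued : Subgraph G
    glued .inL x = inL (F (M (S x))) x
    glued .inR y = inR (F (M (T y))) y
    glued .edge x y = edge (F (M (S x))) x y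
    glued .edge⊆G x y = edge⊆G (F (M (S x))) x y
    glued .edge-endL x y = edge-endL (F (M (S x))) x y
    glued .edge-endR x y e = subst (λ i → inR (F (M i)) y ≡ true) (sym (compatible x y e))
                               (edge-endR (F (M (S x))) x y e)

    part : Vtx G → I
    part (inj₁ x) = S x
    part (inj₂ y) = T y

    inV-local : ∀ u → inV G glued u → inV G (F (M (part u))) u
    inV-local (inj₁ _) h = h
    inV-local (inj₂ _) h = h

    adj-local : ∀ u v → AdjF G glued u v → AdjF G (F (M (part u))) u v × part v ≡ part u
    adj-local (inj₁ x) (inj₂ y) e = e , compatible x y e
    adj-local (inj₂ y) (inj₁ x) e =
      subst (λ i → edge (F (M i)) x y ≡ true) (sym (compatible x y e)) e , sym (compatible x y e)

    walk-local : ∀ {i u v} → part u ≡ i → Walk G glued u v → Walk G (F (M i)) u v × part v ≡ i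
    walk-local refl (here h) = here (inV-local _ h) , refl
    walk-local refl (step {u} {v} a w) with a' , eq ← adj-local u v a
      with w' , eq' ← walk-local eq w = step a' w' , eq'

    -- By `compatible` no edge leaves its part, so a walk or cycle stays in the part where it starts
    -- and already lies in one of the given matchings. All edges at a left vertex come from a single
    -- matching, which settles the degrees.
    glue : Matching24 G
    glue .F = glued
    glue .acyclic C = acyclic (M i) record
      { k = Cycle.k C ; c = c ; inj = inj
      ; cons = λ j → local (inject₁ j) (suc j) (cons j)
      ; close = local (fromℕ _) zero close }
      where
      open Cycle C using (c; inj; cons; close)
      i = part (c zero)
      same : ∀ j → part (c j) ≡ i
      -- Induction along the cycle: consecutive vertices share a part.
      same = <-weakInduction (λ j → part (c j) ≡ i) refl
               (λ j eq → trans (proj₂ (adj-local (c (inject₁ j)) (c (suc j)) (cons j))) eq)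
      local : ∀ j j' → AdjF G glued (c j) (c j') → AdjF G (F (M i)) (c j) (c j')
      local j j' a = subst (λ i → AdjF G (F (M i)) (c j) (c j')) (same j)
                       (proj₁ (adj-local (c j) (c j') a))
    glue .small v e e-inj h = small (M (part v)) v e e-inj local
      where
      local : ∀ j → let (x , y) = e j in
              (edge (F (M (part v))) x y ≡ true) × Walk G (F (M (part v))) v (inj₁ x)
      local j with a , w ← h j with w' , eq ← walk-local refl w =
        subst (λ i → edge (F (M i)) (proj₁ (e j)) (proj₂ (e j)) ≡ true) eq a , w'
    glue .deg2 x = deg2 (M (S x)) x

  -- Acyclicity when at most one right vertex branches.

  module _ (H : Subgraph G) where

    IsR : Vtx G → Set
    IsR v = ∃ λ y → v ≡ inj₂ y

    after-L : ∀ {u v x} → u ≡ inj₁ x → AdjF G H u v → IsR v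
    after-L {v = inj₂ y} refl _ = y , refl

    no-triangle : ∀ u v w → AdjF G H u v → AdjF G H v w → AdjF G H w u → ⊥
    no-triangle (inj₁ _) (inj₂ _) (inj₁ _) _ _ ()
    no-triangle (inj₂ _) (inj₁ _) (inj₂ _) _ _ ()

    module _ (r : Fin n)
             (branch : ∀ y x x' → edge H x y ≡ true → edge H x' y ≡ true → x ≢ x' → y ≡ r) where

      -- Both `u` and `w` are right vertices with two distinct neighbours, so `branch` makes each
      -- equal to `r`. The ends `t` and `z` may coincide, as they do on a 4-cycle.
      no-two-branches : ∀ {t u v w z} → AdjF G H t u → AdjF G H u v → AdjF G H v w → AdjF G H w z →
                        t ≢ v → v ≢ z → u ≢ w → IsR u → ⊥
      no-two-branches {inj₁ x} {inj₂ y} {inj₁ x'} {inj₂ y'} {inj₁ x''} a b c d t≢v v≢z u≢w _ =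
        u≢w (cong inj₂ (trans (branch y x x' a b (t≢v ∘ cong inj₁))
                              (sym (branch y' x' x'' c d (v≢z ∘ cong inj₁)))))
      no-two-branches {u = inj₁ _} _ _ _ _ _ _ _ (_ , ())

      -- A cycle of length at least 4 passes through two right vertices at
      -- distance two, each having two neighbours on the cycle.
      acyclic-of-one-branch : Acyclic G H
      acyclic-of-one-branch record { k = zero ; c = c ; cons = cons ; close = close } =
        no-triangle (c zero) (c (suc zero)) (c (suc (suc zero)))
          (cons zero) (cons (suc zero)) close
      acyclic-of-one-branch record { k = suc k ; c = c ; inj = inj ; cons = cons ; close = close } =
        start (c zero) refl
        where
        apart : ∀ {i j} → i ≢ j → c i ≢ c j
        apart i≢j = i≢j ∘ inj
        -- The vertex after the fourth one: the first again on a 4-cycle, otherwise the fifth.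
        next : ∀ l (c : Fin (4 ℕ.+ l) → Vtx G) →
               (∀ i → AdjF G H (c (inject₁ i)) (c (suc i))) → AdjF G H (c (fromℕ (3 ℕ.+ l))) (c zero) →
               ∃ λ j → AdjF G H (c (suc (suc (suc zero)))) (c j) × suc (suc zero) ≢ j
        next zero    c cons close = zero , close , λ ()
        next (suc l) c cons close = suc (suc (suc (suc zero))) , cons (suc (suc (suc zero))) , λ ()
        start : ∀ v → c zero ≡ v → ⊥
        start (inj₁ x) eq with j , a , 2≢j ← next k c cons close =
          no-two-branches (cons zero) (cons (suc zero)) (cons (suc (suc zero))) a
            (apart (λ ())) (apart 2≢j) (apart (λ ())) (after-L eq (cons zero))
        start (inj₂ y) eq =
          no-two-branches close (cons zero) (cons (suc zero)) (cons (suc (suc zero)))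
            (apart (λ ())) (apart (λ ())) (apart (λ ())) (y , eq)

  -- Removable right vertices and the matching around them.

  degR : Fin n → ℕ
  degR r = count m (λ x → adj x r)

  pendant : Fin n → Bool
  pendant b = does (degR b ℕ.≟ 1)

  private-nbr : Fin m → Fin n → Bool
  private-nbr x b = adj x b ∧ pendant b

  pendant-unique : ∀ {b x x'} → pendant b ≡ true → adj x b ≡ true → adj x' b ≡ true → x ≡ x'
  pendant-unique {b} eq = count-unique (λ x → adj x b) (ℕ.≤-reflexive (does-sound (degR b ℕ.≟ 1) eq)) _ _

  -- The neighbours of a removable r can be covered by right vertices that no
  -- other left vertex sees: each takes r and a pendant vertex.
  Removable : Fin n → Set
  Removable r = 1 ≤ degR r × degR r ≤ 2 ×
                (∀ x → adj x r ≡ true → ∃ λ b → b ≢ r × private-nbr x b ≡ true)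

  removable? : ∀ r → Dec (Removable r)
  removable? r = 1 ℕ.≤? degR r ×-dec degR r ℕ.≤? 2 ×-dec
    all? λ x → (adj x r Bool.≟ true) →-dec any? λ b → ¬? (b ≟ r) ×-dec (private-nbr x b Bool.≟ true)

  module _ (r : Fin n) (removable : Removable r) where

    partner : Fin m → Fin n
    partner x with adj x r Bool.≟ true
    ... | yes a = proj₁ (proj₂ (proj₂ removable) x a)
    -- A default value: `star-adj` has no edge at such an `x`.
    ... | no  _ = r

    partner-spec : ∀ x → adj x r ≡ true → partner x ≢ r × private-nbr x (partner x) ≡ true
    partner-spec x a with adj x r Bool.≟ true
    ... | yes a' = proj₂ (proj₂ (proj₂ removable) x a')
    ... | no ¬a  = contradiction a ¬a

    star-adj : Fin m → Fin n → Bool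
    star-adj x y = adj x r ∧ (does (y ≟ r) ∨ does (y ≟ partner x))

    star-edge : ∀ x y → star-adj x y ≡ true → adj x r ≡ true × (y ≡ r ⊎ y ≡ partner x)
    star-edge x y e with a , e' ← ∧-true e with ∨-true e'
    ... | inj₁ eq = a , inj₁ (does-sound (y ≟ r) eq)
    ... | inj₂ eq = a , inj₂ (does-sound (y ≟ partner x) eq)

    star : Subgraph G
    star .inL x = adj x r
    -- Right vertices outside the star become isolated, hence trivial tree components.
    star .inR _ = true
    star .edge = star-adj
    star .edge⊆G x y e with star-edge x y e
    ... | a , inj₁ refl = a
    ... | a , inj₂ refl = proj₁ (∧-true (proj₂ (partner-spec x a)))
    star .edge-endL x y e = proj₁ (∧-true e)
    star .edge-endR _ _ _ = refl

    partner-unique : ∀ x x' → adj x r ≡ true → adj x' (partner x) ≡ true → x ≡ x'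
    partner-unique x x' a a' with b , p ← ∧-true (proj₂ (partner-spec x a)) = pendant-unique p b a'

    -- A right end other than `r` is some partner; partners are pendant, so only `r` can have two
    -- neighbours in the star.
    star-branch : ∀ y x x' → edge star x y ≡ true → edge star x' y ≡ true → x ≢ x' → y ≡ r
    star-branch y x x' e e' x≢x' with star-edge x y e
    ... | _ , inj₁ y≡r  = y≡r
    ... | a , inj₂ refl = contradiction (partner-unique x x' a (edge⊆G star x' y e')) x≢x'

    star-matching : Matching24 G
    star-matching .F = star
    star-matching .acyclic = acyclic-of-one-branch star r star-branch
    -- The whole star has at most four edges: an edge is coded by its left end, one of at most two
    -- neighbours of `r`, and a bit telling whether it goes to `r` or to the partner.
    star-matching .small v e e-inj h =
      ℕ.<⇒≱ (s≤s (ℕ.*-monoˡ-≤ 2 (proj₁ (proj₂ removable)))) (injective⇒≤ code-injective)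
      where
      info : ∀ j → adj (proj₁ (e j)) r ≡ true × (proj₂ (e j) ≡ r ⊎ proj₂ (e j) ≡ partner (proj₁ (e j)))
      info j = star-edge _ _ (proj₁ (h j))
      bit : {A B : Set} → A ⊎ B → Fin 2
      bit = [ (λ _ → zero) , (λ _ → suc zero) ]′
      end-determined : ∀ {x x' y y'} (s : y ≡ r ⊎ y ≡ partner x) (s' : y' ≡ r ⊎ y' ≡ partner x') →
                       x ≡ x' → bit s ≡ bit s' → y ≡ y'
      end-determined (inj₁ p) (inj₁ q) _    _ = trans p (sym q)
      end-determined (inj₂ p) (inj₂ q) refl _ = trans p (sym q)
      code : Fin 5 → Fin (degR r ℕ.* 2)
      code j = combine (rank (λ x → adj x r) _ (proj₁ (info j))) (bit (proj₂ (info j)))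
      code-injective : Injective _≡_ _≡_ code
      code-injective {i} {j} eq with p , q ← combine-injective _ _ _ _ eq
        with x≡x' ← rank-injective (λ x → adj x r) _ _ (proj₁ (info i)) (proj₁ (info j)) p =
        e-inj (cong₂ _,_ x≡x' (end-determined (proj₂ (info i)) (proj₂ (info j)) x≡x' q))
    star-matching .deg2 x a =
      trans (count-cong (λ y → cong (_∧ (does (y ≟ r) ∨ does (y ≟ partner x))) a))
            (count-doubleton r (partner x) (proj₁ (partner-spec x a) ∘ sym))

    extend : (∀ S → ProperSubsetL G S → ∃ λ M → Covers G M S) → ∃ λ M → Covers G M (allL G)
    extend cover-proper = glue M S T compatible , covers
      where
      S : Fin m → Bool
      S x = adj x r
      T : Fin n → Bool
      T y = anyF m (λ x → star-adj x y)
      rest : ∃ λ N → Covers G N (not ∘ S)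
      -- The complement of `S` is proper because it misses a neighbour of `r`.
      rest with x , a ← count-witness S (proj₁ removable) = cover-proper (not ∘ S) (x , cong not a)
      M : Bool → Matching24 G
      M true  = star-matching
      M false = proj₁ rest
      compatible : ∀ x y → edge (F (M (S x))) x y ≡ true → T y ≡ S x
      compatible x y e with S x in Sx
      ... | true  = anyF-complete (λ x → star-adj x y) x e
      ... | false with T y in Ty
      ...   | false = refl
      -- An edge from `x` outside `S` would meet the star in `r`, making `x` a neighbour of `r`, or
      -- in a pendant partner, whose only neighbour lies in `S`.
      ...   | true with x' , e' ← anyF-sound (λ x → star-adj x y) Ty with star-edge x' y e'
      ...     | _ , inj₁ refl = false≢true Sx (edge⊆G (F (M false)) x y e)
      ...     | a , inj₂ refl with refl ← partner-unique x' x a (edge⊆G (F (M false)) x y e) =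
        false≢true Sx a
      covers : Covers G (glue M S T compatible) (allL G)
      covers x _ with S x in Sx
      ... | true  = Sx
      ... | false = proj₂ rest x (cong not Sx)

  -- Discharging when no right vertex is removable.

  module _ (deg≤3 : ∀ x → degL G x ≤ 3) (irreducible : ¬ ∃ Removable) where

    has-private : Fin m → Bool
    has-private x = anyF n (private-nbr x)

    unserved : Fin m → Fin n → Bool
    unserved x r = adj x r ∧ not (has-private x)

    -- x gives its neighbour r five units if r is pendant; otherwise two or
    -- three units, according to whether x has a pendant neighbour or not.
    weight : Fin m → Fin n → ℕ
    weight x r = 2 ℕ.* indicator (adj x r) ℕ.+ 3 ℕ.* indicator (private-nbr x r) ℕ.+ indicator (unserved x r)

    -- Of two pendant neighbours `b`, `b'` of `x`, the first would be removable: its only neighbour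
    -- `x` can take `b'` as partner.
    private≤1 : ∀ x → count n (private-nbr x) ≤ 1
    private≤1 x = ℕ.≮⇒≥ λ h → two-private (count-pair-witness (private-nbr x) h)
      where
      two-private : ¬ (∃ λ b → ∃ λ b' → b ≢ b' × private-nbr x b ≡ true × private-nbr x b' ≡ true)
      two-private (b , b' , b≢b' , p , p') with a , d ← ∧-true p =
        irreducible (b , ℕ.≤-reflexive (sym deg≡1) , ℕ.≤-trans (ℕ.≤-reflexive deg≡1) (s≤s z≤n) ,
          λ x' a' → b' , b≢b' ∘ sym , subst (λ z → private-nbr z b' ≡ true) (pendant-unique d a a') p')
        where
        deg≡1 : degR b ≡ 1
        deg≡1 = does-sound (degR b ℕ.≟ 1) d

    -- With a pendant neighbour the three terms are at most 6 + 3 + 0, without one at most 6 + 0 +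
    -- 3.
    given : ∀ x → sum (weight x) ≤ 9
    given x = subst (_≤ 9) (sym (count-combination (adj x) (private-nbr x) (unserved x))) bound
      where
      bound : 2 ℕ.* degL G x ℕ.+ 3 ℕ.* count n (private-nbr x) ℕ.+ count n (unserved x) ≤ 9
      bound with has-private x in eq
      ... | true = ℕ.+-mono-≤ (ℕ.+-mono-≤ (ℕ.*-monoʳ-≤ 2 (deg≤3 x)) (ℕ.*-monoʳ-≤ 3 (private≤1 x)))
                     (ℕ.≤-reflexive (count-none _ (λ r → Bool.∧-zeroʳ (adj x r))))
      ... | false = ℕ.+-mono-≤ (ℕ.+-mono-≤ (ℕ.*-monoʳ-≤ 2 (deg≤3 x)) (ℕ.*-monoʳ-≤ 3 (ℕ.≤-reflexive no-private)))
                     (ℕ.≤-trans (ℕ.≤-reflexive (count-cong (λ r → Bool.∧-identityʳ (adj x r)))) (deg≤3 x))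
        where
        no-private : count n (private-nbr x) ≡ 0
        no-private = count-none _ λ b → Bool.¬-not (false≢true eq ∘ anyF-complete (private-nbr x) b)

    -- Degree one yields 2 + 3 and degree at least three yields 6 or more. Degree two yields 4 plus
    -- one unit from an unserved neighbour, which exists since otherwise `r` would be removable.
    received : ∀ r → 1 ≤ degR r → 5 ≤ sum (λ x → weight x r)
    received r 1≤d = subst (5 ≤_)
      (sym (count-combination (λ x → adj x r) (λ x → private-nbr x r) (λ x → unserved x r))) bound
      where
      bound : 5 ≤ 2 ℕ.* degR r ℕ.+ 3 ℕ.* count m (λ x → private-nbr x r) ℕ.+ count m (λ x → unserved x r)
      bound with ℕ.m≤n⇒m<n∨m≡n 1≤d
      ... | inj₂ 1≡d = ℕ.≤-trans
        (ℕ.+-mono-≤ (ℕ.*-monoʳ-≤ 2 1≤d) (ℕ.*-monoʳ-≤ 3 (ℕ.≤-trans 1≤d (ℕ.≤-reflexive (sym all-private)))))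
        (ℕ.m≤m+n _ _)
        where
        all-private : count m (λ x → private-nbr x r) ≡ degR r
        all-private = count-cong λ x →
          trans (cong (adj x r ∧_) (dec-true (degR r ℕ.≟ 1) (sym 1≡d))) (Bool.∧-identityʳ (adj x r))
      ... | inj₁ 2≤d with ℕ.m≤n⇒m<n∨m≡n 2≤d
      ... | inj₁ 3≤d = ℕ.≤-trans (ℕ.n≤1+n 5) (ℕ.≤-trans (ℕ.*-monoʳ-≤ 2 3≤d) (ℕ.≤-trans (ℕ.m≤m+n _ _) (ℕ.m≤m+n _ _)))
      ... | inj₂ 2≡d = ℕ.+-mono-≤ (ℕ.≤-trans (ℕ.*-monoʳ-≤ 2 2≤d) (ℕ.m≤m+n _ _)) some-unserved
        where
        private-other : ∀ x → adj x r ≡ true → unserved x r ≢ true → ∃ λ b → b ≢ r × private-nbr x b ≡ true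
        private-other x a ¬u with has-private x in eq
        ... | false = contradiction (trans (Bool.∧-identityʳ (adj x r)) a) ¬u
        ... | true with b , p ← anyF-sound (private-nbr x) eq = b , b≢r , p
          where
          b≢r : b ≢ r
          -- The pendant `b` has degree one, but `r` has degree two.
          b≢r refl with () ← trans 2≡d (does-sound (degR b ℕ.≟ 1) (proj₂ (∧-true p)))
        some-unserved : 1 ≤ count m (λ x → unserved x r)
        some-unserved = ℕ.≮⇒≥ λ none → irreducible
          (r , 1≤d , ℕ.≤-reflexive (sym 2≡d) , λ x a →
            private-other x a λ u → ℕ.<⇒≱ none (count-positive (λ x → unserved x r) x u))

    -- Double counting: the total weight is bounded below by right vertices and above by left
    -- vertices.
    irreducible-bound : sizeNL G ℕ.* 5 ≤ m ℕ.* 9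
    irreducible-bound = ℕ.≤-trans
      (count-sum-bound 5 _ _ λ r h → let x , a = anyF-sound (λ x → adj x r) h in
        received r (count-positive (λ x → adj x r) x a))
      (ℕ.≤-trans (ℕ.≤-reflexive (sym (∑-comm weight))) (sum-upper-bound 9 (sum ∘ weight) given))

  -- Treated apart because the strict inequality of the main case would read 0 < 0 here.
  cover-empty : m ≡ 0 → ∃ λ M → Covers G M (allL G)
  cover-empty m≡0 = M , λ x → ⊥-elim (no-left x)
    where
    no-left : Fin m → ⊥
    no-left x with () ← subst Fin m≡0 x
    isolated : Subgraph G
    isolated .inL _ = false
    isolated .inR _ = false
    isolated .edge _ _ = false
    isolated .edge⊆G x = ⊥-elim (no-left x)
    isolated .edge-endL x = ⊥-elim (no-left x)
    isolated .edge-endR x = ⊥-elim (no-left x)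
    M : Matching24 G
    M .F = isolated
    M .acyclic C = no-edge (Cycle.c C zero) (Cycle.c C (suc zero)) (Cycle.cons C zero)
      where
      no-edge : ∀ u v → ¬ AdjF G isolated u v
      no-edge (inj₁ x) _ _ = no-left x
      no-edge (inj₂ _) (inj₁ x) _ = no-left x
    M .small v e _ _ = no-left (proj₁ (e zero))
    M .deg2 x = ⊥-elim (no-left x)

-- Rational arithmetic and the final contradiction.

size-bound : ∀ {ε} a b → ε < (+ 1) / 23 → ((+ 2) / 1 - ε) * ℕtoℚ (suc a) Q.≤ ℕtoℚ b →
             45 ℕ.* suc a ℕ.< b ℕ.* 23
size-bound {ε} a b ε< h =
  subst (ℕ._< b ℕ.* 23) (ℕ.*-identityʳ _) (ℤ.drop‿+<+
    (subst (_ ℤ.<_) (sym (ℤ.pos-* b 23)) (ℚᵘ.drop-*<* unnormalised)))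
  where
  instance
    positive : Q.Positive (ℕtoℚ (suc a))
    positive = Q.normalize-pos (suc a) 1
  -- Here 45/23 is the value of 2 - 1/23; multiplying the strict inequality needs a positive factor,
  -- hence `suc a`.
  scaled : ((+ 45) / 23) * ℕtoℚ (suc a) < ℕtoℚ b
  scaled = Q.<-≤-trans
    (Q.*-monoˡ-<-pos (ℕtoℚ (suc a)) (Q.+-monoʳ-< ((+ 2) / 1) (Q.neg-antimono-< ε<))) h
  value : ∀ c → Q.toℚᵘ (ℕtoℚ c) ℚᵘ.≃ ℚᵘ.mkℚᵘ (+ c) 0
  value c = Q.toℚᵘ-fromℚᵘ (ℚᵘ.mkℚᵘ (+ c) 0)
  -- Normalisation by the gcd does not compute on variables; unnormalised fractions reduce to
  -- cross-multiplied integers. `mkℚᵘ` stores the denominator minus one, so 22 stands for 23.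
  unnormalised : ℚᵘ.mkℚᵘ (+ 45) 22 ℚᵘ.* ℚᵘ.mkℚᵘ (+ suc a) 0 ℚᵘ.< ℚᵘ.mkℚᵘ (+ b) 0
  unnormalised = ℚᵘ.<-respʳ-≃ (value b) (ℚᵘ.<-respˡ-≃
    (ℚᵘ.≃-trans (Q.toℚᵘ-homo-* ((+ 45) / 23) (ℕtoℚ (suc a)))
      (ℚᵘ.*-congˡ {ℚᵘ.mkℚᵘ (+ 45) 22} (value (suc a))))
    (Q.toℚᵘ-mono-< scaled))

theorem2 : (ε : ℚ) → ε < (+ 1) / 23 →
    (G : BipGraph) →
    (∀ x → degL G x ≤ 3) →
    DistinctDeg3Nbhds G →
    (((+ 2) / 1 - ε) * ℕtoℚ (BipGraph.m G)) Q.≤ ℕtoℚ (sizeNL G) →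
    (∀ S → ProperSubsetL G S → ∃ λ M → Covers G M S) →
    ∃ λ M → Covers G M (allL G)
theorem2 ε ε< G deg≤3 _ large cover-proper with any? (removable? G)
... | yes (r , removable) = extend G r removable cover-proper
... | no irreducible = cover-irreducible (BipGraph.m G) refl
  where
  N : ℕ
  N = sizeNL G
  cover-irreducible : ∀ l → BipGraph.m G ≡ l → ∃ λ M → Covers G M (allL G)
  cover-irreducible zero    eq = cover-empty G eq
  -- With `m` the size of `L`, the chain gives 25 `N` ≤ 45 `m` < 23 `N`, which is absurd.
  cover-irreducible (suc a) eq = contradiction (ℕ.m≤m+n (N ℕ.* 23) (N ℕ.* 2)) (ℕ.<⇒≱ (begin-strict
    N ℕ.* 23 ℕ.+ N ℕ.* 2       ≡⟨ regroup N ⟩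
    5 ℕ.* (N ℕ.* 5)            ≤⟨ ℕ.*-monoʳ-≤ 5 (irreducible-bound G deg≤3 irreducible) ⟩
    5 ℕ.* (BipGraph.m G ℕ.* 9) ≡⟨ cong (λ l → 5 ℕ.* (l ℕ.* 9)) eq ⟩
    5 ℕ.* (suc a ℕ.* 9)        ≡⟨ commute (suc a) ⟩
    45 ℕ.* suc a               <⟨ size-bound a N ε< (subst (λ l → ((+ 2) / 1 - ε) * ℕtoℚ l Q.≤ ℕtoℚ N) eq large) ⟩
    N ℕ.* 23                   ∎))
    where
    open ℕ.≤-Reasoning
    regroup : ∀ N → N ℕ.* 23 ℕ.+ N ℕ.* 2 ≡ 5 ℕ.* (N ℕ.* 5)
    regroup = solve-∀
    commute : ∀ l → 5 ℕ.* (l ℕ.* 9) ≡ 45 ℕ.* l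
    commute = solve-∀
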